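{- Let $A$ and $B$ be two disjoint sets of integers, with $|A| = m$ and $|B| = n$. For each $u \in \mathfrak{S}_A$ and $v \in \mathfrak{S}_B$, the distribution of cyclic descent number over all cyclic shuffles of $[u]$ and $[v]$ is given by \[ \sum_{[w] \in [u] \,\sqcup\!\sqcup_{\mathrm{cyc}}\, [v]} q^{\mathrm{cdes}(w)} = (1-q)^{m+n} \sum_r \binom{r+m-\mathrm{cdes}(u)-1}{m-1} \binom{r+n-\mathrm{cdes}(v)-1}{n-1} r q^r. \]
   Context: For a finite set $A$ of size $a$, $\mathfrak{S}_A$ is the set of bijections $u:[a]\to A$, viewed as words $u=(u_1,\ldots,u_a)$. For a set of integers $A$ and $u\in\mathfrak{S}_A$, the cyclic descent set is $\mathrm{cDes}(u):=\{1\le i\le a : u_i>u_{i+1}\}$ with $u_{a+1}:=u_1$, and $\mathrm{cdes}(u):=|\mathrm{cDes}(u)|$, which depends only on the cyclic class $[u]$ of $u$ under cyclic rotations. For disjoint $A,B$, a cyclic shuffle of $[u]$ and $[v]$ is a class $[w]$, $w\in\mathfrak{S}_{A\sqcup B}$, having a representative that is a shuffle (contains both as subwords) of some cyclic shift of $u$ and some cyclic shift of $v$; $[u]\,\sqcup\!\sqcup_{\mathrm{cyc}}\,[v]$ denotes the set of all such cyclic shuffles. -}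

module Defs where

open import Data.Nat as ℕ using (ℕ; zero; suc; _∸_; _≡ᵇ_)
open import Data.Nat.Combinatorics using (_C_)
open import Data.Integer as ℤ using (ℤ; +_; _<?_)
open import Data.Bool using (if_then_else_)
open import Data.List using (List; []; _∷_; _++_; take; drop; length; foldr; map; upTo)
open import Data.List.Relation.Unary.All using (All)
open import Data.List.Relation.Unary.Any using (Any)
open import Data.List.Relation.Unary.AllPairs using (AllPairs)
open import Data.List.Relation.Binary.Sublist.Propositional using (_⊆_)
open import Data.List.Relation.Binary.Permutation.Propositional using (_↭_)
open import Data.Product using (Σ; _×_; ∃-syntax)
open import Relation.Nullary using (¬_; does)
open import Relation.Binary.PropositionalEquality using (_≡_)

-- Words over the integers (a word u ∈ 𝔖_A is a list whose entries are
-- the elements of A, each exactly once).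
Word : Set
Word = List ℤ

rotate : ℕ → Word → Word
rotate i w = drop i w ++ take i w

CycEq : Word → Word → Set
CycEq w w' = ∃[ i ] (rotate i w ≡ w')

desc : Word → ℕ
desc (x ∷ y ∷ r) = (if does (y <? x) then 1 else 0) ℕ.+ desc (y ∷ r)
desc _ = 0

cdes : Word → ℕ
cdes w = desc (w ++ take 1 w)

-- [w] is a cyclic shuffle of [u] and [v], where w ∈ 𝔖_{A ⊔ B}
-- (A, B given as duplicate-free lists): some cyclic shift of w
-- contains some cyclic shift of u and some cyclic shift of v as subwords.
IsCycShuffle : (A B u v w : Word) → Set
IsCycShuffle A B u v w =
  (w ↭ (A ++ B)) ×
  ∃[ k ] ∃[ i ] ∃[ j ] ((rotate i u ⊆ rotate k w) × (rotate j v ⊆ rotate k w))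

IsRepSystem : (A B u v : Word) → List Word → Set
IsRepSystem A B u v Ws =
  All (IsCycShuffle A B u v) Ws ×
  AllPairs (λ w w' → ¬ CycEq w w') Ws ×
  (∀ w → IsCycShuffle A B u v w → Any (CycEq w) Ws)

-- Formal power series in q with integer coefficients, as coefficient
-- functions; equality is coefficientwise.

PS : Set
PS = ℕ → ℤ

_+ₚ_ : PS → PS → PS
(f +ₚ g) k = f k ℤ.+ g k

zeroₚ : PS
zeroₚ _ = + 0

_*ₚ_ : PS → PS → PS
(f *ₚ g) k = foldr ℤ._+_ (+ 0) (map (λ i → f i ℤ.* g (k ∸ i)) (upTo (suc k)))

oneₚ : PS
oneₚ zero = + 1
oneₚ (suc _) = + 0

_^ₚ_ : PS → ℕ → PS
f ^ₚ zero = oneₚ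
f ^ₚ suc n = f *ₚ (f ^ₚ n)

monoₚ : ℕ → PS
monoₚ d k = if d ≡ᵇ k then + 1 else + 0

oneMinusQ : PS
oneMinusQ zero = + 1
oneMinusQ (suc zero) = ℤ.-[1+ 0 ]
oneMinusQ (suc (suc _)) = + 0

cdesGF : List Word → PS
cdesGF Ws = foldr (λ w s → monoₚ (cdes w) +ₚ s) zeroₚ Ws

-- Σ_r C(r+m-c-1, m-1) C(r+n-d-1, n-1) r q^r   (c = cdes u, d = cdes v)
-- (for m,n ≥ 1 and c ≤ m-1, d ≤ n-1 the truncated subtractions are exact)
rhsSeries : (m n c d : ℕ) → PS
rhsSeries m n c d r =
  + (((r ℕ.+ m ∸ c ∸ 1) C (m ∸ 1)) ℕ.* ((r ℕ.+ n ∸ d ∸ 1) C (n ∸ 1)) ℕ.* r)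

{-# OPTIONS --safe #-}

-- Place the letters of a word w, in order, into r linearly ordered boxes so that
-- no box contains a descent.  The number of placements is a binomial coefficient
-- in desc w, and merging the boxes shows that it is multiplicative: summed over
-- the shuffles of two disjoint words it gives the product.  A word of length N
-- with cdes w = c has c rotations with c - 1 descents and N - c with c descents,
-- so summing over rotations gives r * C(r + N - 1 - c, N - 1).  The words in the
-- cyclic shuffles of [u] and [v] are exactly the shuffles of a rotation of u with
-- a rotation of v; comparing the two sums and cancelling r gives
--   Σ_[w] C(r + m + n - 1 - cdes w, m + n - 1)
--     = r C(r + m - 1 - cdes u, m - 1) C(r + n - 1 - cdes v, n - 1),
-- which is the coefficient of q^r in the claim divided by (1 - q)^(m + n).
module Submission where

open import Defs
open import Data.Bool using (Bool; true; false; if_then_else_; not)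
open import Data.Integer as ℤ using (ℤ; +_; _<?_)
import Data.Integer.Properties as ℤ
import Data.Integer.Tactic.RingSolver as ℤ-Solver
open import Data.List using (List; []; _∷_; _++_; map; length; head; take; drop; filter; foldr; applyUpTo; concatMap; cartesianProduct; deduplicate)
import Data.List.Membership.DecPropositional as DecMembership
open import Data.List.Membership.Propositional using (_∈_; _∉_; find; lose)
open import Data.List.Membership.Propositional.Properties using (∈-map⁺; ∈-map⁻; ∈-++⁺ˡ; ∈-++⁺ʳ; ∈-++⁻; ∈-concatMap⁺; ∈-concatMap⁻; ∈-cartesianProduct⁺; ∈-cartesianProduct⁻)
open import Data.List.Membership.Propositional.Properties.WithK using (unique∧set⇒bag)
open import Data.List.Properties using (++-identityʳ; ++-assoc; ∷-injectiveˡ; ∷-injectiveʳ; ≡-dec; filter-++; filter-accept; filter-all; filter-none; filter-reject; length-++; length-++-comm; map-++; map-upTo; map-∘; take++drop≡id)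
open import Data.List.Relation.Binary.BagAndSetEquality using (∼bag⇒↭)
open import Data.List.Relation.Binary.Equality.Propositional using (≋⇒≡)
open import Data.List.Relation.Binary.Permutation.Propositional using (_↭_; ↭-refl; ↭-sym; ↭-trans; ↭-prep; ↭⇒↭ₛ)
open import Data.List.Relation.Binary.Permutation.Propositional.Properties using (shift; ++-comm; ++⁺; ↭-length; filter-↭; All-resp-↭; ∈-resp-↭) renaming (map⁺ to map-↭)
import Data.List.Relation.Binary.Permutation.Setoid.Properties as ↭ₛ
open import Data.List.Relation.Binary.Sublist.Propositional using (_⊆_; []; _∷_; _∷ʳ_)
import Data.List.Relation.Binary.Sublist.Propositional.Properties as Sublist
open import Data.List.Relation.Unary.All as All using (All; []; _∷_)
import Data.List.Relation.Unary.All.Properties as All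
open import Data.List.Relation.Unary.AllPairs as AllPairs using (AllPairs; []; _∷_)
open import Data.List.Relation.Unary.Any as Any using (here; there)
import Data.List.Relation.Unary.Any.Properties as Any
import Data.List.Relation.Unary.Unique.DecSetoid.Properties as DecUnique
open import Data.List.Relation.Unary.Unique.Propositional using (Unique)
import Data.List.Relation.Unary.Unique.Propositional.Properties as Unique
open import Data.Maybe using (Maybe; just; nothing)
open import Data.Maybe.Properties using (just-injective)
open import Data.Nat using (ℕ; zero; suc; _+_; _*_; _∸_; _≤_; z≤n; s≤s)
open import Data.Nat.Combinatorics using (_C_; k>n⇒nCk≡0; nC1≡n; nCk+nC[k+1]≡[n+1]C[k+1]; nCk≡nC[n∸k]; nCn≡1)
open import Data.Nat.ListAction using (sum)
open import Data.Nat.ListAction.Properties using (sum-++; sum-↭)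
open import Data.Nat.Properties hiding (_<?_)
open import Data.Nat.Tactic.RingSolver using (solve-∀)
open import Data.Product using (Σ; ∃-syntax; _×_; _,_; proj₁; proj₂; uncurry)
open import Data.Sum using (inj₁; inj₂)
open import Function using (_∘_; mk⇔)
open import Level using (0ℓ)
open import Relation.Binary.Bundles using (DecSetoid)
open import Relation.Binary.Definitions using (tri<; tri≈; tri>)
open import Relation.Binary.PropositionalEquality
open import Relation.Nullary using (¬_; Dec; does; yes; no; contradiction; map′)
open import Relation.Nullary.Decidable using (¬?; dec-false; dec-true)
open import Relation.Unary using (Pred; Decidable; ∁)

-- Binomial identities

nC0≡1 : ∀ n → n C 0 ≡ 1
nC0≡1 n = trans (nCk≡nC[n∸k] {k = 0} {n = n} z≤n) (nCn≡1 n)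

-- Absorption, (k+1) C(n,k+1) = (n-k) C(n,k), with the subtraction moved across so that nothing is
-- truncated. Pascal's rule on both binomials reduces `n`.
C-absorption : ∀ n k → suc k * (n C suc k) + k * (n C k) ≡ n * (n C k)
C-absorption zero zero = refl
C-absorption zero (suc k) = cong₂ _+_ (*-zeroʳ (suc (suc k))) (*-zeroʳ (suc k))
C-absorption (suc n) zero = begin
  1 * (suc n C 1) + 0  ≡⟨ cong (λ z → 1 * z + 0) (nC1≡n (suc n)) ⟩
  1 * suc n + 0        ≡⟨ solve-1 n ⟩
  suc n * 1            ≡⟨ cong (suc n *_) (nC0≡1 (suc n)) ⟨
  suc n * (suc n C 0)  ∎
  where
  open ≡-Reasoning
  solve-1 : ∀ n → 1 * suc n + 0 ≡ suc n * 1
  solve-1 = solve-∀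
C-absorption (suc n) (suc j) = begin
  suc (suc j) * (suc n C suc (suc j)) + suc j * (suc n C suc j)
    ≡⟨ cong₂ (λ y z → suc (suc j) * y + suc j * z) (nCk+nC[k+1]≡[n+1]C[k+1] n (suc j)) (nCk+nC[k+1]≡[n+1]C[k+1] n j) ⟨
  suc (suc j) * (b + c) + suc j * (a + b)
    ≡⟨ regroup j a b c ⟩
  (suc (suc j) * c + suc j * b) + (suc j * b + j * a) + (a + b)
    ≡⟨ cong₂ (λ y z → y + z + (a + b)) (C-absorption n (suc j)) (C-absorption n j) ⟩
  n * b + n * a + (a + b)
    ≡⟨ collect n a b ⟩
  suc n * (a + b)
    ≡⟨ cong (suc n *_) (nCk+nC[k+1]≡[n+1]C[k+1] n j) ⟩
  suc n * (suc n C suc j) ∎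
  where
  open ≡-Reasoning
  a b c : ℕ
  a = n C j
  b = n C suc j
  c = n C suc (suc j)
  regroup : ∀ j a b c → suc (suc j) * (b + c) + suc j * (a + b) ≡
            (suc (suc j) * c + suc j * b) + (suc j * b + j * a) + (a + b)
  regroup = solve-∀
  collect : ∀ n a b → n * b + n * a + (a + b) ≡ suc n * (a + b)
  collect = solve-∀

-- The left side is the total over the k + 1 rotations of a word with c cyclic descents: each gives
-- `X C suc k`, and c of them an extra `X C k`. Adding `k * (X C k)` to both sides makes absorption
-- applicable, and X + c = ρ + k + 1 finishes.
C-rotation-sum : ∀ ρ k c → c ≤ ρ + suc k → let X = ρ + suc k ∸ c in
                 suc k * (X C suc k) + c * (X C k) ≡ suc ρ * (X C k)
C-rotation-sum ρ k c c≤ = +-cancelʳ-≡ (k * (X C k)) _ _ (begin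
  suc k * (X C suc k) + c * (X C k) + k * (X C k)    ≡⟨ swap (suc k * (X C suc k)) (c * (X C k)) (k * (X C k)) ⟩
  (suc k * (X C suc k) + k * (X C k)) + c * (X C k)  ≡⟨ cong (_+ c * (X C k)) (C-absorption X k) ⟩
  X * (X C k) + c * (X C k)                          ≡⟨ *-distribʳ-+ (X C k) X c ⟨
  (X + c) * (X C k)                                  ≡⟨ cong (_* (X C k)) (m∸n+n≡m c≤) ⟩
  (ρ + suc k) * (X C k)                              ≡⟨ split ρ k (X C k) ⟩
  suc ρ * (X C k) + k * (X C k)                      ∎)
  where
  open ≡-Reasoning
  X : ℕ
  X = ρ + suc k ∸ c
  swap : ∀ x y z → x + y + z ≡ (x + z) + y
  swap = solve-∀
  split : ∀ ρ k z → (ρ + suc k) * z ≡ suc ρ * z + k * z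
  split = solve-∀

-- Power series

-- Multiplication by 1 - q, read off on coefficients.
Δ : PS → PS
Δ f zero    = f zero
Δ f (suc k) = f (suc k) ℤ.- f k

Δ^ : ℕ → PS → PS
Δ^ zero    f = f
Δ^ (suc n) f = Δ (Δ^ n f)

Δ-cong : ∀ {f g} → f ≗ g → Δ f ≗ Δ g
Δ-cong f≗g zero    = f≗g zero
Δ-cong f≗g (suc k) = cong₂ ℤ._-_ (f≗g (suc k)) (f≗g k)

Δ^-cong : ∀ n {f g} → f ≗ g → Δ^ n f ≗ Δ^ n g
Δ^-cong zero    f≗g = f≗g
Δ^-cong (suc n) f≗g = Δ-cong (Δ^-cong n f≗g)

-- `Δ^` adds differences on the outside, while Pascal's rule for `binomialSeries` consumes the
-- innermost one.
Δ^-Δ : ∀ n f → Δ^ n (Δ f) ≗ Δ (Δ^ n f)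
Δ^-Δ zero    f k = refl
Δ^-Δ (suc n) f   = Δ-cong (Δ^-Δ n f)

Δ-+ₚ : ∀ f g → Δ (f +ₚ g) ≗ Δ f +ₚ Δ g
Δ-+ₚ f g zero    = refl
Δ-+ₚ f g (suc k) = interchange (f (suc k)) (g (suc k)) (f k) (g k)
  where
  interchange : ∀ a b c d → (a ℤ.+ b) ℤ.- (c ℤ.+ d) ≡ (a ℤ.- c) ℤ.+ (b ℤ.- d)
  interchange = ℤ-Solver.solve-∀

Δ^-+ₚ : ∀ n f g → Δ^ n (f +ₚ g) ≗ Δ^ n f +ₚ Δ^ n g
Δ^-+ₚ zero    f g k = refl
Δ^-+ₚ (suc n) f g k = trans (Δ-cong (Δ^-+ₚ n f g) k) (Δ-+ₚ (Δ^ n f) (Δ^ n g) k)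

Δ^-zeroₚ : ∀ n → Δ^ n zeroₚ ≗ zeroₚ
Δ^-zeroₚ zero    k       = refl
Δ^-zeroₚ (suc n) zero    = Δ^-zeroₚ n zero
Δ^-zeroₚ (suc n) (suc k) = cong₂ ℤ._-_ (Δ^-zeroₚ n (suc k)) (Δ^-zeroₚ n k)

-- With `applyUpTo` the term of index 0 splits off by computation, which suits the convolution sums
-- below.
sumTo : ℕ → (ℕ → ℤ) → ℤ
sumTo n h = foldr ℤ._+_ (+ 0) (applyUpTo h n)

sumTo-cong : ∀ n {h h′ : ℕ → ℤ} → h ≗ h′ → sumTo n h ≡ sumTo n h′
sumTo-cong zero    h≗h′ = refl
sumTo-cong (suc n) h≗h′ = cong₂ ℤ._+_ (h≗h′ 0) (sumTo-cong n (h≗h′ ∘ suc))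

sumTo-zero : ∀ n {h : ℕ → ℤ} → (∀ i → h i ≡ + 0) → sumTo n h ≡ + 0
sumTo-zero zero    h≗0 = refl
sumTo-zero (suc n) h≗0 = cong₂ ℤ._+_ (h≗0 0) (sumTo-zero n (h≗0 ∘ suc))

sumTo-minus : ∀ n (h h′ : ℕ → ℤ) → sumTo n (λ i → h i ℤ.- h′ i) ≡ sumTo n h ℤ.- sumTo n h′
sumTo-minus zero    h h′ = refl
sumTo-minus (suc n) h h′ = trans
  (cong (λ z → (h 0 ℤ.- h′ 0) ℤ.+ z) (sumTo-minus n (h ∘ suc) (h′ ∘ suc)))
  (interchange (h 0) (h′ 0) (sumTo n (h ∘ suc)) (sumTo n (h′ ∘ suc)))
  where
  interchange : ∀ a b c d → (a ℤ.- b) ℤ.+ (c ℤ.- d) ≡ (a ℤ.+ c) ℤ.- (b ℤ.+ d)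
  interchange = ℤ-Solver.solve-∀

*ₚ-sumTo : ∀ f g k → (f *ₚ g) k ≡ sumTo (suc k) (λ i → f i ℤ.* g (k ∸ i))
*ₚ-sumTo f g k = cong (foldr ℤ._+_ (+ 0)) (map-upTo (λ i → f i ℤ.* g (k ∸ i)) (suc k))

*ₚ-congˡ : ∀ {f f′} g → f ≗ f′ → f *ₚ g ≗ f′ *ₚ g
*ₚ-congˡ {f} {f′} g f≗f′ k = begin
  (f *ₚ g) k                                 ≡⟨ *ₚ-sumTo f g k ⟩
  sumTo (suc k) (λ i → f i ℤ.* g (k ∸ i))    ≡⟨ sumTo-cong (suc k) (λ i → cong (ℤ._* g (k ∸ i)) (f≗f′ i)) ⟩
  sumTo (suc k) (λ i → f′ i ℤ.* g (k ∸ i))   ≡⟨ *ₚ-sumTo f′ g k ⟨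
  (f′ *ₚ g) k                                ∎
  where open ≡-Reasoning

oneₚ-*ₚ : ∀ g → oneₚ *ₚ g ≗ g
oneₚ-*ₚ g k = begin
  (oneₚ *ₚ g) k                                   ≡⟨ *ₚ-sumTo oneₚ g k ⟩
  + 1 ℤ.* g k ℤ.+ sumTo k (λ i → + 0 ℤ.* g (k ∸ suc i))
    ≡⟨ cong₂ ℤ._+_ (ℤ.*-identityˡ (g k)) (sumTo-zero k (λ i → ℤ.*-zeroˡ (g (k ∸ suc i)))) ⟩
  g k ℤ.+ + 0                                     ≡⟨ ℤ.+-identityʳ (g k) ⟩
  g k                                             ∎
  where open ≡-Reasoning

oneMinusQ-*ₚ : ∀ g → oneMinusQ *ₚ g ≗ Δ g
oneMinusQ-*ₚ g zero = trans (ℤ.+-identityʳ _) (ℤ.*-identityˡ (g zero))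
oneMinusQ-*ₚ g (suc k) = begin
  (oneMinusQ *ₚ g) (suc k)  ≡⟨ *ₚ-sumTo oneMinusQ g (suc k) ⟩
  + 1 ℤ.* g (suc k) ℤ.+ (ℤ.-[1+ 0 ] ℤ.* g k ℤ.+ sumTo k (λ i → + 0 ℤ.* g (k ∸ suc i)))
    ≡⟨ cong (λ z → + 1 ℤ.* g (suc k) ℤ.+ (ℤ.-[1+ 0 ] ℤ.* g k ℤ.+ z))
         (sumTo-zero k (λ i → ℤ.*-zeroˡ (g (k ∸ suc i)))) ⟩
  + 1 ℤ.* g (suc k) ℤ.+ (ℤ.-[1+ 0 ] ℤ.* g k ℤ.+ + 0)
    ≡⟨ cong₂ ℤ._+_ (ℤ.*-identityˡ (g (suc k))) (trans (ℤ.+-identityʳ _) (ℤ.-1*i≡-i (g k))) ⟩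
  g (suc k) ℤ.- g k         ∎
  where open ≡-Reasoning

-- Associativity for the factor 1 - q. The subtracted terms `f i`, shifted by one index, form the
-- convolution one degree lower.
Δ-*ₚ : ∀ f g → Δ f *ₚ g ≗ Δ (f *ₚ g)
Δ-*ₚ f g zero = refl
Δ-*ₚ f g (suc k) = begin
  (Δ f *ₚ g) (suc k)
    ≡⟨ *ₚ-sumTo (Δ f) g (suc k) ⟩
  f 0 ℤ.* g (suc k) ℤ.+ sumTo (suc k) (λ i → (f (suc i) ℤ.- f i) ℤ.* g (k ∸ i))
    ≡⟨ cong (λ z → f 0 ℤ.* g (suc k) ℤ.+ z) (trans
         (sumTo-cong (suc k) (λ i → distrib (f (suc i)) (f i) (g (k ∸ i))))
         (sumTo-minus (suc k) (λ i → f (suc i) ℤ.* g (k ∸ i)) (λ i → f i ℤ.* g (k ∸ i)))) ⟩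
  f 0 ℤ.* g (suc k) ℤ.+ (S₁ ℤ.- S₀)
    ≡⟨ ℤ.+-assoc (f 0 ℤ.* g (suc k)) S₁ (ℤ.- S₀) ⟨
  (f 0 ℤ.* g (suc k) ℤ.+ S₁) ℤ.- S₀
    ≡⟨ cong₂ ℤ._-_ (*ₚ-sumTo f g (suc k)) (*ₚ-sumTo f g k) ⟨
  (f *ₚ g) (suc k) ℤ.- (f *ₚ g) k ∎
  where
  open ≡-Reasoning
  S₀ S₁ : ℤ
  S₀ = sumTo (suc k) (λ i → f i ℤ.* g (k ∸ i))
  S₁ = sumTo (suc k) (λ i → f (suc i) ℤ.* g (k ∸ i))
  distrib : ∀ a b c → (a ℤ.- b) ℤ.* c ≡ a ℤ.* c ℤ.- b ℤ.* c
  distrib = ℤ-Solver.solve-∀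

oneMinusQ^-*ₚ : ∀ n g → (oneMinusQ ^ₚ n) *ₚ g ≗ Δ^ n g
oneMinusQ^-*ₚ zero    g k = oneₚ-*ₚ g k
oneMinusQ^-*ₚ (suc n) g k = begin
  ((oneMinusQ *ₚ (oneMinusQ ^ₚ n)) *ₚ g) k  ≡⟨ *ₚ-congˡ g (oneMinusQ-*ₚ (oneMinusQ ^ₚ n)) k ⟩
  (Δ (oneMinusQ ^ₚ n) *ₚ g) k               ≡⟨ Δ-*ₚ (oneMinusQ ^ₚ n) g k ⟩
  Δ ((oneMinusQ ^ₚ n) *ₚ g) k               ≡⟨ Δ-cong (oneMinusQ^-*ₚ n g) k ⟩
  Δ (Δ^ n g) k                              ∎
  where open ≡-Reasoning

-- The expansion of q^c / (1 - q)^n.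
binomialSeries : ℕ → ℕ → PS
binomialSeries n       (suc c) zero    = + 0
binomialSeries n       (suc c) (suc r) = binomialSeries n c r
binomialSeries zero    zero    r       = oneₚ r
binomialSeries (suc n) zero    r       = + ((r + n) C n)

-- Removing one factor from the denominator of q^c / (1 - q)^(n+1) is Pascal's rule on coefficients;
-- the factor q^c only shifts them.
Δ-binomialSeries : ∀ n c → Δ (binomialSeries (suc n) c) ≗ binomialSeries n c
Δ-binomialSeries zero    zero zero = refl
Δ-binomialSeries (suc n) zero zero = cong +_ (trans (nCn≡1 (suc n)) (sym (nCn≡1 n)))
Δ-binomialSeries zero zero (suc r) =
  cong₂ (λ x y → + x ℤ.- + y) (nC0≡1 (suc r + 0)) (nC0≡1 (r + 0))
Δ-binomialSeries (suc n) zero (suc r) = begin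
  + ((suc r + suc n) C suc n) ℤ.- + b  ≡⟨ cong (λ x → + x ℤ.- + b) (nCk+nC[k+1]≡[n+1]C[k+1] (r + suc n) n) ⟨
  + (a + b) ℤ.- + b                    ≡⟨ cancel (+ a) (+ b) ⟩
  + a                                  ≡⟨ cong (λ x → + (x C n)) (+-suc r n) ⟩
  + ((suc r + n) C n)                  ∎
  where
  open ≡-Reasoning
  a b : ℕ
  a = (r + suc n) C n
  b = (r + suc n) C suc n
  cancel : ∀ x y → (x ℤ.+ y) ℤ.- y ≡ x
  cancel = ℤ-Solver.solve-∀
Δ-binomialSeries n (suc c) zero          = refl
Δ-binomialSeries n (suc c) (suc zero)    = trans (ℤ.+-identityʳ _) (Δ-binomialSeries n c zero)
Δ-binomialSeries n (suc c) (suc (suc r)) = Δ-binomialSeries n c (suc r)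

binomialSeries-monoₚ : ∀ c → binomialSeries 0 c ≗ monoₚ c
binomialSeries-monoₚ zero    zero    = refl
binomialSeries-monoₚ zero    (suc r) = refl
binomialSeries-monoₚ (suc c) zero    = refl
binomialSeries-monoₚ (suc c) (suc r) = binomialSeries-monoₚ c r

Δ^-binomialSeries : ∀ n c → Δ^ n (binomialSeries n c) ≗ monoₚ c
Δ^-binomialSeries zero    c k = binomialSeries-monoₚ c k
Δ^-binomialSeries (suc n) c k = begin
  Δ (Δ^ n (binomialSeries (suc n) c)) k  ≡⟨ Δ^-Δ n (binomialSeries (suc n) c) k ⟨
  Δ^ n (Δ (binomialSeries (suc n) c)) k  ≡⟨ Δ^-cong n (Δ-binomialSeries n c) k ⟩
  Δ^ n (binomialSeries n c) k            ≡⟨ Δ^-binomialSeries n c k ⟩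
  monoₚ c k                              ∎
  where open ≡-Reasoning

-- The bound keeps truncation harmless: for n = 0 and c > r the coefficient is 0, but the truncated
-- formula would read `0 C 0`, which is 1.
binomialSeries-C : ∀ n c r → c ≤ r + n → binomialSeries (suc n) c r ≡ + ((r + n ∸ c) C n)
binomialSeries-C n zero    r       c≤r+n       = refl
binomialSeries-C n (suc c) zero    c<n         = cong +_ (sym (k>n⇒nCk≡0 (∸-monoʳ-< {n} {suc c} {0} (s≤s z≤n) c<n)))
binomialSeries-C n (suc c) (suc r) (s≤s c≤r+n) = binomialSeries-C n c r c≤r+n

binomialSeries-zero : ∀ n {c} → 1 ≤ c → binomialSeries n c 0 ≡ + 0
binomialSeries-zero n (s≤s _) = refl

-- Distributing words over boxes

-- `nothing` stands for an empty box and `just x` for a box whose last letter is `x`.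
fits : Maybe ℤ → ℤ → Bool
fits nothing  y = true
fits (just x) y = not (does (y <? x))

-- placements r x w counts the ways to distribute the letters of w, in order,
-- over a current box and r further boxes so that each box receives a word
-- without descents, where the current box already ends with the letter x.
placements : ℕ → Maybe ℤ → Word → ℕ
placements r       x []      = 1
placements zero    x (y ∷ w) = if fits x y then placements zero (just y) w else 0
placements (suc r) x (y ∷ w) =
  (if fits x y then placements (suc r) (just y) w else 0) + placements r nothing (y ∷ w)

-- The placements that close the current box and start afresh in the next one. The value 0 when no
-- box is left lets both clauses of `placements` take one form.
later : ℕ → Word → ℕ
later zero    w = 0
later (suc r) w = placements r nothing w

placements-∷ : ∀ r x y w → placements r x (y ∷ w) ≡
               (if fits x y then placements r (just y) w else 0) + later r (y ∷ w)
placements-∷ zero    x y w = sym (+-identityʳ _)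
placements-∷ (suc r) x y w = refl

descAfter : Maybe ℤ → Word → ℕ
descAfter nothing  w = desc w
descAfter (just x) w = desc (x ∷ w)

descent : ℤ → ℤ → ℕ
descent x y = if does (y <? x) then 1 else 0

descent≤1 : ∀ x y → descent x y ≤ 1
descent≤1 x y with does (y <? x)
... | true  = s≤s z≤n
... | false = z≤n

desc-∷-≤ : ∀ x w → desc (x ∷ w) ≤ length w
desc-∷-≤ x []      = z≤n
desc-∷-≤ x (y ∷ w) = +-mono-≤ (descent≤1 x y) (desc-∷-≤ y w)

mutual

  -- The first letter either enters the current box or waits for a later one, and Pascal's rule adds
  -- the two counts. A descent from `x` forbids the first option; it also lowers the top of the
  -- binomial by one, leaving exactly the second count.
  placements-C : ∀ r x w → placements r x w ≡ (r + length w ∸ descAfter x w) C length w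
  placements-C r x []      = sym (nC0≡1 (r + 0 ∸ descAfter x []))
  placements-C r x (y ∷ w) = trans (placements-∷ r x y w) (step x)
    where
    open ≡-Reasoning
    n δ : ℕ
    n = length w
    δ = desc (y ∷ w)
    δ≤r+n : δ ≤ r + n
    δ≤r+n = ≤-trans (desc-∷-≤ y w) (m≤n+m n r)
    fitting : placements r (just y) w + later r (y ∷ w) ≡ (r + suc n ∸ δ) C suc n
    fitting = begin
      placements r (just y) w + later r (y ∷ w)      ≡⟨ cong₂ _+_ (placements-C r (just y) w) (later-C r y w) ⟩
      (r + n ∸ δ) C n + (r + n ∸ δ) C suc n          ≡⟨ nCk+nC[k+1]≡[n+1]C[k+1] (r + n ∸ δ) n ⟩
      suc (r + n ∸ δ) C suc n                        ≡⟨ cong (_C suc n) (+-∸-assoc 1 δ≤r+n) ⟨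
      (suc (r + n) ∸ δ) C suc n                      ≡⟨ cong (λ z → (z ∸ δ) C suc n) (+-suc r n) ⟨
      (r + suc n ∸ δ) C suc n                        ∎
    step : ∀ x → (if fits x y then placements r (just y) w else 0) + later r (y ∷ w) ≡
                 (r + suc n ∸ descAfter x (y ∷ w)) C suc n
    step nothing = fitting
    step (just x) with does (y <? x)
    ... | false = fitting
    ... | true  = trans (later-C r y w) (cong (λ z → (z ∸ suc δ) C suc n) (sym (+-suc r n)))

  later-C : ∀ r y w → later r (y ∷ w) ≡ (r + length w ∸ desc (y ∷ w)) C suc (length w)
  -- With no box left the count is 0, and so is the binomial, whose top is at most `length w`.
  later-C zero    y w = sym (k>n⇒nCk≡0 (s≤s (m∸n≤m (length w) (desc (y ∷ w)))))
  later-C (suc r) y w = trans (placements-C r nothing (y ∷ w))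
    (cong (λ z → (z ∸ desc (y ∷ w)) C suc (length w)) (+-suc r (length w)))

-- Shuffles of two words and multiplicativity of placements

shuffles : Word → Word → List Word
shuffles []      v       = v ∷ []
shuffles (a ∷ u) []      = (a ∷ u) ∷ []
shuffles (a ∷ u) (b ∷ v) = map (a ∷_) (shuffles u (b ∷ v)) ++ map (b ∷_) (shuffles (a ∷ u) v)

sum-map-++ : ∀ {A : Set} (f : A → ℕ) xs ys → sum (map f (xs ++ ys)) ≡ sum (map f xs) + sum (map f ys)
sum-map-++ f xs ys = trans (cong sum (map-++ f xs ys)) (sum-++ (map f xs) (map f ys))

sum-map-zero : ∀ {A : Set} (xs : List A) → sum (map (λ _ → 0) xs) ≡ 0
sum-map-zero []       = refl
sum-map-zero (x ∷ xs) = sum-map-zero xs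

sum-map-if : ∀ {A : Set} b (f : A → ℕ) xs →
             sum (map (λ z → if b then f z else 0) xs) ≡ (if b then sum (map f xs) else 0)
sum-map-if true  f xs = refl
sum-map-if false f xs = sum-map-zero xs

sum-map-+ : ∀ {A : Set} (f g : A → ℕ) xs →
            sum (map (λ z → f z + g z) xs) ≡ sum (map f xs) + sum (map g xs)
sum-map-+ f g []       = refl
sum-map-+ f g (x ∷ xs) = trans (cong (λ z → f x + g x + z) (sum-map-+ f g xs))
  (interchange (f x) (g x) (sum (map f xs)) (sum (map g xs)))
  where
  interchange : ∀ a b c d → a + b + (c + d) ≡ (a + c) + (b + d)
  interchange = solve-∀

sum-map-cong-∈ : ∀ {A : Set} {f g : A → ℕ} xs → (∀ {x} → x ∈ xs → f x ≡ g x) → sum (map f xs) ≡ sum (map g xs)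
sum-map-cong-∈ []       f≗g = refl
sum-map-cong-∈ (x ∷ xs) f≗g = cong₂ _+_ (f≗g (here refl)) (sum-map-cong-∈ xs (λ p → f≗g (there p)))

sum-placements-∷ : ∀ r x a ws → sum (map (placements r x) (map (a ∷_) ws)) ≡
  (if fits x a then sum (map (placements r (just a)) ws) else 0) + sum (map (later r) (map (a ∷_) ws))
sum-placements-∷ r x a ws = begin
  sum (map (placements r x) (map (a ∷_) ws))
    ≡⟨ cong sum (map-∘ {g = placements r x} {f = a ∷_} ws) ⟨
  sum (map (λ w → placements r x (a ∷ w)) ws)
    ≡⟨ sum-map-cong-∈ ws (λ {w} _ → placements-∷ r x a w) ⟩
  sum (map (λ w → (if fits x a then placements r (just a) w else 0) + later r (a ∷ w)) ws)
    ≡⟨ sum-map-+ (λ w → if fits x a then placements r (just a) w else 0) (λ w → later r (a ∷ w)) ws ⟩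
  sum (map (λ w → if fits x a then placements r (just a) w else 0) ws) + sum (map (λ w → later r (a ∷ w)) ws)
    ≡⟨ cong₂ _+_ (sum-map-if (fits x a) (placements r (just a)) ws)
                 (cong sum (map-∘ {g = later r} {f = a ∷_} ws)) ⟩
  (if fits x a then sum (map (placements r (just a)) ws) else 0) + sum (map (later r) (map (a ∷_) ws)) ∎
  where open ≡-Reasoning

fits-trans : ∀ x {a b} → a ℤ.< b → fits x a ≡ true → fits x b ≡ true
fits-trans nothing  a<b _ = refl
fits-trans (just x) {a} {b} a<b fit with a <? x
fits-trans (just x) {a} {b} a<b () | yes _
... | no a≮x = cong not (dec-false (b <? x) (λ b<x → a≮x (ℤ.<-trans a<b b<x)))

fits-< : ∀ {a b} → a ℤ.< b → fits (just a) b ≡ true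
fits-< {a} {b} a<b = cong not (dec-false (b <? a) (ℤ.<-asym a<b))

fits-> : ∀ {a b} → a ℤ.< b → fits (just b) a ≡ false
fits-> {a} {b} a<b = cong not (dec-true (a <? b) a<b)

-- The product expands according to which of `a` and `b` enter the current box. If both do, the
-- smaller `a` must come first, so only one of the two shuffle orders yields `α * β`. If just one
-- enters, it comes first in the shuffle; if neither does, the term is `U * V`.
fits-product : ∀ x {a b} → a ℤ.< b → ∀ α β U V →
  (if fits x a then α * ((if fits (just a) b then β else 0) + V) else 0) +
  (if fits x b then ((if fits (just b) a then α else 0) + U) * β else 0) + U * V ≡
  ((if fits x a then α else 0) + U) * ((if fits x b then β else 0) + V)
fits-product x {a} {b} a<b α β U V
  rewrite fits-< a<b | fits-> a<b with fits x a in fitsᵃ | fits x b in fitsᵇ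
... | true  | true  = both α β U V
  where
  both : ∀ α β U V → α * (β + V) + U * β + U * V ≡ (α + U) * (β + V)
  both = solve-∀
... | false | true  = sym (*-distribˡ-+ U β V)
... | false | false = refl
-- Whatever admits `a` also admits the larger `b`.
... | true  | false with () ← trans (sym fitsᵇ) (fits-trans x a<b fitsᵃ)

-- Shuffles are split by their first letter, and placements by whether that letter enters the
-- current box. The induction hypotheses are arguments, which keeps the algebra out of the
-- recursion.
placements-shuffle-step : ∀ r x {a b} u v → a ≢ b →
  let ws = shuffles u (b ∷ v) ; ws′ = shuffles (a ∷ u) v in
  sum (map (placements r (just a)) ws) ≡ placements r (just a) u * placements r (just a) (b ∷ v) →
  sum (map (placements r (just b)) ws′) ≡ placements r (just b) (a ∷ u) * placements r (just b) v →
  sum (map (later r) (shuffles (a ∷ u) (b ∷ v))) ≡ later r (a ∷ u) * later r (b ∷ v) →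
  sum (map (placements r x) (shuffles (a ∷ u) (b ∷ v))) ≡ placements r x (a ∷ u) * placements r x (b ∷ v)
placements-shuffle-step r x {a} {b} u v a≢b first second rest = begin
  sum (map (placements r x) (map (a ∷_) ws ++ map (b ∷_) ws′))
    ≡⟨ sum-map-++ (placements r x) (map (a ∷_) ws) (map (b ∷_) ws′) ⟩
  sum (map (placements r x) (map (a ∷_) ws)) + sum (map (placements r x) (map (b ∷_) ws′))
    ≡⟨ cong₂ _+_ (sum-placements-∷ r x a ws) (sum-placements-∷ r x b ws′) ⟩
  ((if fits x a then Sᵃ else 0) + L) + ((if fits x b then Sᵇ else 0) + L′)
    ≡⟨ interchange (if fits x a then Sᵃ else 0) L (if fits x b then Sᵇ else 0) L′ ⟩
  (if fits x a then Sᵃ else 0) + (if fits x b then Sᵇ else 0) + (L + L′)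
    ≡⟨ cong₂ _+_ (cong₂ (λ y z → (if fits x a then y else 0) + (if fits x b then z else 0))
         (trans first (cong (α *_) (placements-∷ r (just a) b v)))
         (trans second (cong (_* β) (placements-∷ r (just b) a u))))
         (trans (sym (sum-map-++ (later r) (map (a ∷_) ws) (map (b ∷_) ws′))) rest) ⟩
  (if fits x a then α * ((if fits (just a) b then β else 0) + V) else 0) +
  (if fits x b then ((if fits (just b) a then α else 0) + U) * β else 0) + U * V
    ≡⟨ product ⟩
  ((if fits x a then α else 0) + U) * ((if fits x b then β else 0) + V)
    ≡⟨ cong₂ _*_ (placements-∷ r x a u) (placements-∷ r x b v) ⟨
  placements r x (a ∷ u) * placements r x (b ∷ v) ∎
  where
  open ≡-Reasoning
  ws ws′ : List Word
  ws  = shuffles u (b ∷ v)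
  ws′ = shuffles (a ∷ u) v
  α β U V L L′ Sᵃ Sᵇ : ℕ
  α = placements r (just a) u
  β = placements r (just b) v
  U = later r (a ∷ u)
  V = later r (b ∷ v)
  L = sum (map (later r) (map (a ∷_) ws))
  L′ = sum (map (later r) (map (b ∷_) ws′))
  Sᵃ = sum (map (placements r (just a)) ws)
  Sᵇ = sum (map (placements r (just b)) ws′)
  interchange : ∀ y l z l′ → (y + l) + (z + l′) ≡ y + z + (l + l′)
  interchange = solve-∀
  product :
    (if fits x a then α * ((if fits (just a) b then β else 0) + V) else 0) +
    (if fits x b then ((if fits (just b) a then α else 0) + U) * β else 0) + U * V ≡
    ((if fits x a then α else 0) + U) * ((if fits x b then β else 0) + V)
  product with ℤ.<-cmp a b
  ... | tri< a<b _ _ = fits-product x a<b α β U V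
  ... | tri≈ _ a≡b _ = contradiction a≡b a≢b
  -- The identity is symmetric in the two words, so the previous case applies with `b` as the
  -- smaller letter.
  ... | tri> _ _ b<a = begin
    (if fits x a then α * Vᵃ else 0) + (if fits x b then Uᵇ * β else 0) + U * V
      ≡⟨ cong₂ _+_ (+-comm (if fits x a then α * Vᵃ else 0) (if fits x b then Uᵇ * β else 0)) (*-comm U V) ⟩
    (if fits x b then Uᵇ * β else 0) + (if fits x a then α * Vᵃ else 0) + V * U
      ≡⟨ cong₂ (λ y z → (if fits x b then y else 0) + (if fits x a then z else 0) + V * U)
           (*-comm Uᵇ β) (*-comm α Vᵃ) ⟩
    (if fits x b then β * Uᵇ else 0) + (if fits x a then Vᵃ * α else 0) + V * U
      ≡⟨ fits-product x b<a β α V U ⟩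
    ((if fits x b then β else 0) + V) * ((if fits x a then α else 0) + U)
      ≡⟨ *-comm ((if fits x b then β else 0) + V) ((if fits x a then α else 0) + U) ⟩
    ((if fits x a then α else 0) + U) * ((if fits x b then β else 0) + V) ∎
    where
    Uᵇ Vᵃ : ℕ
    Uᵇ = (if fits (just b) a then α else 0) + U
    Vᵃ = (if fits (just a) b then β else 0) + V

mutual

  -- A placement of a shuffle restricts to placements of `u` and `v`. Conversely, the two
  -- descent-free words in a box have no letter in common and so merge into a descent-free word in
  -- exactly one way.
  placements-shuffle : ∀ r x u v → (∀ {a b} → a ∈ u → b ∈ v → a ≢ b) →
    sum (map (placements r x) (shuffles u v)) ≡ placements r x u * placements r x v
  placements-shuffle r x []      v       u#v = refl
  placements-shuffle r x (a ∷ u) []      u#v = trans (+-identityʳ _) (sym (*-identityʳ _))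
  placements-shuffle r x (a ∷ u) (b ∷ v) u#v =
    placements-shuffle-step r x u v (u#v (here refl) (here refl))
      (placements-shuffle r (just a) u (b ∷ v) (u#v ∘ there))
      (placements-shuffle r (just b) (a ∷ u) v (λ p q → u#v p (there q)))
      (later-shuffle r (a ∷ u) (b ∷ v) u#v)

  later-shuffle : ∀ r u v → (∀ {a b} → a ∈ u → b ∈ v → a ≢ b) →
    sum (map (later r) (shuffles u v)) ≡ later r u * later r v
  later-shuffle zero    u v u#v = sum-map-zero (shuffles u v)
  later-shuffle (suc r) u v u#v = placements-shuffle r nothing u v u#v

-- Cyclic rotations

++-rotate : ∀ p q → rotate (length p) (p ++ q) ≡ q ++ p
++-rotate []      q = refl
++-rotate (x ∷ p) q = cong₂ (λ d t → d ++ x ∷ t) (drop-length p) (take-length p)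
  where
  drop-length : ∀ p → drop (length p) (p ++ q) ≡ q
  drop-length []      = refl
  drop-length (x ∷ p) = drop-length p
  take-length : ∀ p → take (length p) (p ++ q) ≡ p
  take-length []      = refl
  take-length (x ∷ p) = cong (x ∷_) (take-length p)

cycEq-++ : ∀ p q → CycEq (p ++ q) (q ++ p)
cycEq-++ p q = length p , ++-rotate p q

cycEq-split : ∀ {w w′} → CycEq w w′ → ∃[ p ] ∃[ q ] (w ≡ p ++ q × w′ ≡ q ++ p)
cycEq-split {w} (i , eq) = take i w , drop i w , sym (take++drop≡id i w) , sym eq

cycEq-refl : ∀ {w} → CycEq w w
cycEq-refl {w} = 0 , ++-identityʳ w

cycEq-sym : ∀ {w w′} → CycEq w w′ → CycEq w′ w
cycEq-sym w~w′ with p , q , refl , refl ← cycEq-split w~w′ = cycEq-++ q p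

cycEq-∷ : ∀ {w} x z → CycEq w (x ∷ z) → CycEq w (z ++ x ∷ [])
cycEq-∷ x z w~ with cycEq-split w~
... | p , []    , refl , refl rewrite ++-identityʳ z = cycEq-++ (x ∷ []) z
... | p , x ∷ q , refl , refl = subst₂ CycEq
  (++-assoc p (x ∷ []) q) (sym (++-assoc q p (x ∷ []))) (cycEq-++ (p ++ x ∷ []) q)

-- Transitivity is reached by moving one letter at a time, which avoids arithmetic on rotation
-- amounts.
cycEq-extend : ∀ {w} p q → CycEq w (p ++ q) → CycEq w (q ++ p)
cycEq-extend {w} []      q w~ = subst (CycEq w) (sym (++-identityʳ q)) w~
cycEq-extend {w} (x ∷ p) q w~ = subst (CycEq w) (++-assoc q (x ∷ []) p)
  (cycEq-extend p (q ++ x ∷ []) (subst (CycEq w) (++-assoc p q (x ∷ [])) (cycEq-∷ x (p ++ q) w~)))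

cycEq-trans : ∀ {w w′ w″} → CycEq w w′ → CycEq w′ w″ → CycEq w w″
cycEq-trans w~w′ w′~w″ with p , q , refl , refl ← cycEq-split w′~w″ = cycEq-extend p q w~w′

-- `p` holds the letters already passed: the list runs over the rotations of `p ++ q` that start at
-- a letter of `q`, one for each position.
rotationsFrom : Word → Word → List Word
rotationsFrom p []      = []
rotationsFrom p (x ∷ q) = (x ∷ q ++ p) ∷ rotationsFrom (p ++ x ∷ []) q

rotations : Word → List Word
rotations = rotationsFrom []

∈-rotationsFrom⁺ : ∀ p q₁ x q₂ → (x ∷ q₂ ++ (p ++ q₁)) ∈ rotationsFrom p (q₁ ++ x ∷ q₂)
∈-rotationsFrom⁺ p []       x q₂ = here (cong (λ z → x ∷ q₂ ++ z) (++-identityʳ p))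
∈-rotationsFrom⁺ p (y ∷ q₁) x q₂ = there (subst (λ z → (x ∷ q₂ ++ z) ∈ rotationsFrom (p ++ y ∷ []) (q₁ ++ x ∷ q₂))
  (++-assoc p (y ∷ []) q₁) (∈-rotationsFrom⁺ (p ++ y ∷ []) q₁ x q₂))

∈-rotationsFrom⁻ : ∀ p q {w} → w ∈ rotationsFrom p q → ∃[ q₁ ] ∃[ q₂ ] (q ≡ q₁ ++ q₂ × w ≡ q₂ ++ (p ++ q₁))
∈-rotationsFrom⁻ p (x ∷ q) (here refl) = [] , x ∷ q , refl , cong (λ z → x ∷ q ++ z) (sym (++-identityʳ p))
∈-rotationsFrom⁻ p (x ∷ q) (there w∈) with q₁ , q₂ , refl , refl ← ∈-rotationsFrom⁻ (p ++ x ∷ []) q w∈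
  = x ∷ q₁ , q₂ , refl , cong (q₂ ++_) (++-assoc p (x ∷ []) q₁)

∈-rotations⁻ : ∀ w {w′} → w′ ∈ rotations w → CycEq w w′
∈-rotations⁻ w w′∈ with q₁ , q₂ , refl , refl ← ∈-rotationsFrom⁻ [] w w′∈ = cycEq-++ q₁ q₂

∈-rotations⁺ : ∀ {w w′} → 1 ≤ length w → CycEq w w′ → w′ ∈ rotations w
∈-rotations⁺ 1≤ w~w′ with cycEq-split w~w′
∈-rotations⁺ ()  _ | []    , []    , refl , refl
-- An empty second piece gives the trivial rotation, which is listed first.
∈-rotations⁺ 1≤  _ | x ∷ p , []    , refl , refl rewrite ++-identityʳ p = here (sym (++-identityʳ (x ∷ p)))
∈-rotations⁺ 1≤  _ | p     , x ∷ q , refl , refl = ∈-rotationsFrom⁺ [] p x q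

cycEq? : ∀ w w′ → Dec (CycEq w w′)
cycEq? []      []      = yes cycEq-refl
cycEq? []      (x ∷ w) = no λ { (zero , ()) ; (suc i , ()) }
cycEq? (x ∷ w) w′      = map′ (∈-rotations⁻ (x ∷ w)) (∈-rotations⁺ (s≤s z≤n)) (DecMembership._∈?_ (≡-dec ℤ._≟_) w′ (rotations (x ∷ w)))

rotationsFrom-heads : ∀ p q → map head (rotationsFrom p q) ≡ map just q
rotationsFrom-heads p []      = refl
rotationsFrom-heads p (x ∷ q) = cong (just x ∷_) (rotationsFrom-heads (p ++ x ∷ []) q)

-- The first letters of the rotations are the letters of `w` itself, so they already tell the
-- rotations apart.
rotations-unique : ∀ {w} → Unique w → Unique (rotations w)
rotations-unique {w} w! = Unique.map⁻ (subst Unique (sym (rotationsFrom-heads [] w)) (Unique.map⁺ just-injective w!))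

length-rotationsFrom : ∀ p q → length (rotationsFrom p q) ≡ length q
length-rotationsFrom p []      = refl
length-rotationsFrom p (x ∷ q) = cong suc (length-rotationsFrom (p ++ x ∷ []) q)

⊆-++-split : ∀ {x : Word} p {q} → x ⊆ p ++ q → ∃[ x₁ ] ∃[ x₂ ] (x ≡ x₁ ++ x₂ × x₁ ⊆ p × x₂ ⊆ q)
⊆-++-split []      x⊆q = [] , _ , refl , [] , x⊆q
⊆-++-split (y ∷ p) (.y ∷ʳ x⊆) with x₁ , x₂ , refl , x₁⊆p , x₂⊆q ← ⊆-++-split p x⊆
  = x₁ , x₂ , refl , y ∷ʳ x₁⊆p , x₂⊆q
⊆-++-split (y ∷ p) (refl ∷ x⊆) with x₁ , x₂ , refl , x₁⊆p , x₂⊆q ← ⊆-++-split p x⊆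
  = y ∷ x₁ , x₂ , refl , refl ∷ x₁⊆p , x₂⊆q

-- The cut that rotates `w` also cuts the subword, and its two pieces are exchanged along with those
-- of `w`.
⊆-cycEq : ∀ {x w w′} → x ⊆ w → CycEq w w′ → ∃[ x′ ] (CycEq x x′ × x′ ⊆ w′)
⊆-cycEq x⊆w w~w′ with p , q , refl , refl ← cycEq-split w~w′
  with x₁ , x₂ , refl , x₁⊆p , x₂⊆q ← ⊆-++-split p x⊆w
  = x₂ ++ x₁ , cycEq-++ x₁ x₂ , Sublist.++⁺ x₂⊆q x₁⊆p

-- Cyclic descents and sums over rotations

lastOf : ℤ → Word → ℤ
lastOf x []      = x
lastOf x (y ∷ w) = lastOf y w

lastOf-++ : ∀ x w l → lastOf x (w ++ l ∷ []) ≡ l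
lastOf-++ x []      l = refl
lastOf-++ x (y ∷ w) l = lastOf-++ y w l

wrap : Word → ℕ
wrap []      = 0
wrap (x ∷ w) = descent (lastOf x w) x

desc-snoc : ∀ x w t → desc (x ∷ w ++ t ∷ []) ≡ desc (x ∷ w) + descent (lastOf x w) t
desc-snoc x []      t = +-identityʳ (descent x t)
desc-snoc x (y ∷ w) t = trans (cong (λ z → descent x y + z) (desc-snoc y w t)) (sym (+-assoc (descent x y) _ _))

cdes-wrap : ∀ w → cdes w ≡ desc w + wrap w
cdes-wrap []      = refl
cdes-wrap (x ∷ w) = desc-snoc x w x

cdes-∷ : ∀ x z → cdes (z ++ x ∷ []) ≡ cdes (x ∷ z)
cdes-∷ x []      = refl
cdes-∷ x (y ∷ z) = begin
  cdes (y ∷ z ++ x ∷ [])                                               ≡⟨ cdes-wrap (y ∷ z ++ x ∷ []) ⟩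
  desc (y ∷ z ++ x ∷ []) + descent (lastOf y (z ++ x ∷ [])) y          ≡⟨ cong (λ l → desc (y ∷ z ++ x ∷ []) + descent l y) (lastOf-++ y z x) ⟩
  desc (y ∷ z ++ x ∷ []) + descent x y                                 ≡⟨ +-comm _ (descent x y) ⟩
  cdes (x ∷ y ∷ z)                                                     ∎
  where open ≡-Reasoning

cdes-++ : ∀ p q → cdes (p ++ q) ≡ cdes (q ++ p)
cdes-++ []      q = cong cdes (sym (++-identityʳ q))
cdes-++ (x ∷ p) q = begin
  cdes (x ∷ p ++ q)           ≡⟨ cdes-∷ x (p ++ q) ⟨
  cdes ((p ++ q) ++ x ∷ [])   ≡⟨ cong cdes (++-assoc p q (x ∷ [])) ⟩
  cdes (p ++ q ++ x ∷ [])     ≡⟨ cdes-++ p (q ++ x ∷ []) ⟩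
  cdes ((q ++ x ∷ []) ++ p)   ≡⟨ cong cdes (++-assoc q (x ∷ []) p) ⟩
  cdes (q ++ x ∷ p)           ∎
  where open ≡-Reasoning

cdes-cycEq : ∀ {w w′} → CycEq w w′ → cdes w ≡ cdes w′
cdes-cycEq w~w′ with p , q , refl , refl ← cycEq-split w~w′ = cdes-++ p q

length-cycEq : ∀ {w w′} → CycEq w w′ → length w ≡ length w′
length-cycEq w~w′ with p , q , refl , refl ← cycEq-split w~w′ = length-++-comm p q

cdes-≤-length : ∀ w → cdes w ≤ length w
cdes-≤-length []      = z≤n
cdes-≤-length (x ∷ w) = ≤-trans (desc-∷-≤ x (w ++ x ∷ []))
  (≤-reflexive (trans (length-++ w) (+-comm (length w) 1)))

desc≡0⇒≤ : ∀ x w t → desc (x ∷ w ++ t ∷ []) ≡ 0 → x ℤ.≤ t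
desc≡0⇒≤ x []      t eq with t <? x
desc≡0⇒≤ x []      t () | yes _
... | no t≮x = ℤ.≮⇒≥ t≮x
desc≡0⇒≤ x (y ∷ w) t eq with y <? x
desc≡0⇒≤ x (y ∷ w) t () | yes _
... | no y≮x = ℤ.≤-trans (ℤ.≮⇒≥ y≮x) (desc≡0⇒≤ y w t eq)

-- Without a cyclic descent the letters would increase weakly all the way round, forcing the first
-- two to be equal. This makes the constant coefficient vanish later.
cdes-positive : ∀ {w} → Unique w → 2 ≤ length w → 1 ≤ cdes w
cdes-positive {x ∷ []}    _ (s≤s ())
cdes-positive {x ∷ y ∷ w} ((x≢y ∷ _) ∷ _) _ with y <? x
... | yes _   = s≤s z≤n
... | no  y≮x = n≢0⇒n>0 λ eq → x≢y (ℤ.≤-antisym (ℤ.≮⇒≥ y≮x) (desc≡0⇒≤ y w x eq))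

-- The seam of a rotation lies just before its starting letter. As the start runs through `q`, the
-- seams run through the adjacent pairs of `l ∷ q`.
sum-wrap-rotationsFrom : ∀ p l q → sum (map wrap (rotationsFrom (p ++ l ∷ []) q)) ≡ desc (l ∷ q)
sum-wrap-rotationsFrom p l []      = refl
sum-wrap-rotationsFrom p l (x ∷ q) = cong₂ _+_
  (cong (λ z → descent z x) (trans (cong (lastOf x) (sym (++-assoc q p (l ∷ [])))) (lastOf-++ x (q ++ p) l)))
  (sum-wrap-rotationsFrom (p ++ l ∷ []) x q)

-- Every cyclic descent lies across the seam of exactly one rotation.
sum-wrap-rotations : ∀ w → sum (map wrap (rotations w)) ≡ cdes w
sum-wrap-rotations []      = refl
sum-wrap-rotations (x ∷ q) = begin
  wrap (x ∷ q ++ []) + sum (map wrap (rotationsFrom (x ∷ []) q))  ≡⟨ cong₂ (λ z s → wrap (x ∷ z) + s) (++-identityʳ q) (sum-wrap-rotationsFrom [] x q) ⟩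
  wrap (x ∷ q) + desc (x ∷ q)                                     ≡⟨ +-comm (wrap (x ∷ q)) _ ⟩
  desc (x ∷ q) + wrap (x ∷ q)                                     ≡⟨ cdes-wrap (x ∷ q) ⟨
  cdes (x ∷ q)                                                    ∎
  where open ≡-Reasoning

-- A descent across the seam makes `desc w` one less than `cdes w`. The top of the binomial is then
-- X + 1, and Pascal's rule splits off `X C k`.
wrap-C : ∀ ρ k w → length w ≡ suc k → let X = ρ + suc k ∸ cdes w in
         (ρ + suc k ∸ desc w) C suc k ≡ X C suc k + wrap w * (X C k)
wrap-C ρ k w@(x ∷ v) refl = go (wrap w) (descent≤1 (lastOf x v) x) (cdes-wrap w)
  where
  open ≡-Reasoning
  M c δ : ℕ
  M = ρ + suc k
  c = cdes w
  δ = desc w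
  c≤M : c ≤ M
  c≤M = ≤-trans (cdes-≤-length w) (m≤n+m (suc k) ρ)
  go : ∀ t → t ≤ 1 → c ≡ δ + t → (M ∸ δ) C suc k ≡ (M ∸ c) C suc k + t * ((M ∸ c) C k)
  go zero _ c≡ = begin
    (M ∸ δ) C suc k       ≡⟨ cong (λ z → (M ∸ z) C suc k) (trans c≡ (+-identityʳ δ)) ⟨
    (M ∸ c) C suc k       ≡⟨ +-identityʳ _ ⟨
    (M ∸ c) C suc k + 0   ∎
  go (suc zero) _ c≡ = begin
    (M ∸ δ) C suc k                      ≡⟨ cong (_C suc k) M∸δ ⟩
    suc (M ∸ c) C suc k                  ≡⟨ nCk+nC[k+1]≡[n+1]C[k+1] (M ∸ c) k ⟨
    (M ∸ c) C k + (M ∸ c) C suc k        ≡⟨ +-comm ((M ∸ c) C k) _ ⟩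
    (M ∸ c) C suc k + (M ∸ c) C k        ≡⟨ cong (λ z → (M ∸ c) C suc k + z) (*-identityˡ _) ⟨
    (M ∸ c) C suc k + 1 * ((M ∸ c) C k)  ∎
    where
    c≡1+δ : c ≡ suc δ
    c≡1+δ = trans c≡ (+-comm δ 1)
    M∸δ : M ∸ δ ≡ suc (M ∸ c)
    M∸δ = trans (cong (suc M ∸_) (sym c≡1+δ)) (+-∸-assoc 1 c≤M)
  go (suc (suc t)) (s≤s ()) _

sum-map-affine : ∀ {A : Set} (f : A → ℕ) a b xs →
                 sum (map (λ x → a + f x * b) xs) ≡ length xs * a + sum (map f xs) * b
sum-map-affine f a b []       = refl
sum-map-affine f a b (x ∷ xs) = trans (cong (λ z → a + f x * b + z) (sum-map-affine f a b xs))
  (regroup a b (f x) (length xs) (sum (map f xs)))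
  where
  regroup : ∀ a b y n s → a + y * b + (n * a + s * b) ≡ suc n * a + (y + s) * b
  regroup = solve-∀

-- The factor `suc ρ` is the number r of boxes: the current one and `ρ` further ones.
sum-placements-rotations : ∀ ρ k w → length w ≡ suc k →
  sum (map (placements ρ nothing) (rotations w)) ≡ suc ρ * ((ρ + suc k ∸ cdes w) C k)
sum-placements-rotations ρ k w |w| = begin
  sum (map (placements ρ nothing) (rotations w))
    ≡⟨ sum-map-cong-∈ (rotations w) (λ w′∈ → rotation (∈-rotations⁻ w w′∈)) ⟩
  sum (map (λ w′ → X C suc k + wrap w′ * (X C k)) (rotations w))
    ≡⟨ sum-map-affine wrap (X C suc k) (X C k) (rotations w) ⟩
  length (rotations w) * (X C suc k) + sum (map wrap (rotations w)) * (X C k)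
    ≡⟨ cong₂ (λ y z → y * (X C suc k) + z * (X C k)) (trans (length-rotationsFrom [] w) |w|) (sum-wrap-rotations w) ⟩
  suc k * (X C suc k) + cdes w * (X C k)
    ≡⟨ C-rotation-sum ρ k (cdes w) (≤-trans (cdes-≤-length w) (≤-trans (≤-reflexive |w|) (m≤n+m (suc k) ρ))) ⟩
  suc ρ * (X C k) ∎
  where
  open ≡-Reasoning
  X : ℕ
  X = ρ + suc k ∸ cdes w
  rotation : ∀ {w′} → CycEq w w′ → placements ρ nothing w′ ≡ X C suc k + wrap w′ * (X C k)
  rotation {w′} w~w′ = begin
    placements ρ nothing w′                        ≡⟨ placements-C ρ nothing w′ ⟩
    (ρ + length w′ ∸ desc w′) C length w′          ≡⟨ cong (λ n → (ρ + n ∸ desc w′) C n) |w′| ⟩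
    (ρ + suc k ∸ desc w′) C suc k                  ≡⟨ wrap-C ρ k w′ |w′| ⟩
    (ρ + suc k ∸ cdes w′) C suc k + wrap w′ * ((ρ + suc k ∸ cdes w′) C k)
      ≡⟨ cong (λ c → (ρ + suc k ∸ c) C suc k + wrap w′ * ((ρ + suc k ∸ c) C k)) (cdes-cycEq w~w′) ⟨
    X C suc k + wrap w′ * (X C k)                  ∎
    where
    |w′| : length w′ ≡ suc k
    |w′| = trans (sym (length-cycEq w~w′)) |w|

-- Cyclic shuffles

cycEq-decSetoid : DecSetoid 0ℓ 0ℓ
cycEq-decSetoid = record
  { Carrier = Word
  ; _≈_ = CycEq
  ; isDecEquivalence = record
    { isEquivalence = record { refl = cycEq-refl ; sym = cycEq-sym ; trans = cycEq-trans }
    ; _≟_ = cycEq?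
    }
  }

cycEq⇒↭ : ∀ {w w′} → CycEq w w′ → w ↭ w′
cycEq⇒↭ w~w′ with p , q , refl , refl ← cycEq-split w~w′ = ++-comm p q

-- Shuffles and the recovery of their factors

shuffles-unique : ∀ u v → (∀ {a b} → a ∈ u → b ∈ v → a ≢ b) → Unique (shuffles u v)
shuffles-unique []      v       u#v = [] ∷ []
shuffles-unique (a ∷ u) []      u#v = [] ∷ []
shuffles-unique (a ∷ u) (b ∷ v) u#v = Unique.++⁺
  (Unique.map⁺ ∷-injectiveʳ (shuffles-unique u (b ∷ v) (u#v ∘ there)))
  (Unique.map⁺ ∷-injectiveʳ (shuffles-unique (a ∷ u) v (λ p q → u#v p (there q))))
  λ (p , q) → let _ , _ , w≡a∷ = ∈-map⁻ (a ∷_) p ; _ , _ , w≡b∷ = ∈-map⁻ (b ∷_) q in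
    u#v (here refl) (here refl) (∷-injectiveˡ (trans (sym w≡a∷) w≡b∷))

shuffles-↭ : ∀ u v {w} → w ∈ shuffles u v → w ↭ u ++ v
shuffles-↭ []      v       (here refl) = ↭-refl
shuffles-↭ (a ∷ u) []      (here refl) = subst ((a ∷ u) ↭_) (sym (++-identityʳ (a ∷ u))) ↭-refl
shuffles-↭ (a ∷ u) (b ∷ v) w∈ with ∈-++⁻ (map (a ∷_) (shuffles u (b ∷ v))) w∈
... | inj₁ p with _ , w′∈ , refl ← ∈-map⁻ (a ∷_) p = ↭-prep a (shuffles-↭ u (b ∷ v) w′∈)
... | inj₂ p with _ , w′∈ , refl ← ∈-map⁻ (b ∷_) p =
  ↭-trans (↭-prep b (shuffles-↭ (a ∷ u) v w′∈)) (↭-sym (shift b (a ∷ u) v))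

∷-∈-shufflesˡ : ∀ {x} u v {w} → w ∈ shuffles u v → (x ∷ w) ∈ shuffles (x ∷ u) v
∷-∈-shufflesˡ []      []      (here refl) = here refl
∷-∈-shufflesˡ (a ∷ u) []      (here refl) = here refl
∷-∈-shufflesˡ u       (b ∷ v) w∈          = ∈-++⁺ˡ (∈-map⁺ _ w∈)

∷-∈-shufflesʳ : ∀ {x} u v {w} → w ∈ shuffles u v → (x ∷ w) ∈ shuffles u (x ∷ v)
∷-∈-shufflesʳ []      v (here refl) = here refl
∷-∈-shufflesʳ (a ∷ u) v w∈          = ∈-++⁺ʳ (map (a ∷_) _) (∈-map⁺ _ w∈)

module _ {P : Pred ℤ 0ℓ} (P? : Decidable P) where

  ∈-shuffles-filter : ∀ w → w ∈ shuffles (filter P? w) (filter (¬? ∘ P?) w)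
  ∈-shuffles-filter []      = here refl
  ∈-shuffles-filter (x ∷ w) with P? x
  ... | yes _ = ∷-∈-shufflesˡ (filter P? w) (filter (¬? ∘ P?) w) (∈-shuffles-filter w)
  ... | no  _ = ∷-∈-shufflesʳ (filter P? w) (filter (¬? ∘ P?) w) (∈-shuffles-filter w)

  filter-↭-++ : ∀ {w a b} → w ↭ a ++ b → All P a → All (∁ P) b → filter P? w ↭ a
  filter-↭-++ {w} {a} {b} w↭ Pa ¬Pb = subst (filter P? w ↭_)
    (trans (filter-++ P? a b)
      (trans (cong₂ _++_ (filter-all P? Pa) (filter-none P? ¬Pb)) (++-identityʳ a)))
    (filter-↭ P? w↭)

  -- All letters of `x` satisfy `P`, so filtering embeds `x` into `filter P? w`. Both have the
  -- length of `a`, and an embedding between words of equal length is an equality.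
  ⊆⇒≡filter : ∀ {x w a b} → x ⊆ w → x ↭ a → w ↭ a ++ b → All P a → All (∁ P) b → x ≡ filter P? w
  ⊆⇒≡filter {x} {w} {a} x⊆w x↭a w↭ Pa ¬Pb = ≋⇒≡ (Sublist.to-≋
    (trans (↭-length x↭a) (sym (↭-length (filter-↭-++ w↭ Pa ¬Pb))))
    (subst (_⊆ filter P? w) (filter-all P? (All-resp-↭ (↭-sym x↭a) Pa))
      (Sublist.filter⁺ P? P? (λ { refl p → p }) x⊆w)))

  -- Each letter reveals its factor. Hence shuffles of different pairs of rotations are different
  -- words.
  filter-shuffle : ∀ u v {w} → All P u → All (∁ P) v → w ∈ shuffles u v →
                   filter P? w ≡ u × filter (¬? ∘ P?) w ≡ v
  filter-shuffle []      v       []        ¬Pv       (here refl) =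
    filter-none P? ¬Pv , filter-all (¬? ∘ P?) ¬Pv
  filter-shuffle (a ∷ u) []      Pu        []        (here refl) =
    filter-all P? Pu , filter-none (¬? ∘ P?) (All.map (λ p ¬p → ¬p p) Pu)
  filter-shuffle (a ∷ u) (b ∷ v) (Pa ∷ Pu) (¬Pb ∷ ¬Pv) w∈
    with ∈-++⁻ (map (a ∷_) (shuffles u (b ∷ v))) w∈
  ... | inj₁ p with _ , w′∈ , refl ← ∈-map⁻ (a ∷_) p
    with eqᵘ , eqᵛ ← filter-shuffle u (b ∷ v) Pu (¬Pb ∷ ¬Pv) w′∈
    = trans (filter-accept P? Pa) (cong (a ∷_) eqᵘ) , trans (filter-reject (¬? ∘ P?) (λ ¬p → ¬p Pa)) eqᵛ
  ... | inj₂ p with _ , w′∈ , refl ← ∈-map⁻ (b ∷_) p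
    with eqᵘ , eqᵛ ← filter-shuffle (a ∷ u) v (Pa ∷ Pu) ¬Pv w′∈
    = trans (filter-reject P? ¬Pb) eqᵘ , trans (filter-accept (¬? ∘ P?) ¬Pb) (cong (b ∷_) eqᵛ)

-- Uniqueness and sums for lists of lists

concatMap-unique : ∀ {A B : Set} (f : A → List B) {xs} → Unique xs → (∀ {x} → x ∈ xs → Unique (f x)) →
  (∀ {x y z} → x ∈ xs → y ∈ xs → z ∈ f x → z ∈ f y → x ≡ y) → Unique (concatMap f xs)
concatMap-unique f []          f! inj = []
concatMap-unique f {x ∷ xs} (x∉xs ∷ xs!) f! inj = Unique.++⁺ (f! (here refl))
  (concatMap-unique f xs! (f! ∘ there) (λ p q → inj (there p) (there q)))
  λ (z∈fx , z∈rest) → let y , y∈xs , z∈fy = find (∈-concatMap⁻ f {xs = xs} z∈rest) in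
    All.lookup x∉xs y∈xs (inj (here refl) (there y∈xs) z∈fx z∈fy)

-- `AllPairs` compares an entry only with later ones; symmetry supplies the other order.
AllPairs-¬⇒≡ : ∀ {A : Set} {R : A → A → Set} → (∀ {x y} → R x y → R y x) → ∀ {xs} →
  AllPairs (λ x y → ¬ R x y) xs → ∀ {x y} → x ∈ xs → y ∈ xs → R x y → x ≡ y
AllPairs-¬⇒≡ R-sym (¬Rx ∷ ps) (here refl) (here refl) r = refl
AllPairs-¬⇒≡ R-sym (¬Rx ∷ ps) (here refl) (there y∈)  r = contradiction r (All.lookup ¬Rx y∈)
AllPairs-¬⇒≡ R-sym (¬Rx ∷ ps) (there x∈)  (here refl) r = contradiction (R-sym r) (All.lookup ¬Rx x∈)
AllPairs-¬⇒≡ R-sym (¬Rx ∷ ps) (there x∈)  (there y∈)  r = AllPairs-¬⇒≡ R-sym ps x∈ y∈ r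

sum-map-concatMap : ∀ {A B : Set} (f : B → ℕ) (g : A → List B) xs →
  sum (map f (concatMap g xs)) ≡ sum (map (λ x → sum (map f (g x))) xs)
sum-map-concatMap f g []       = refl
sum-map-concatMap f g (x ∷ xs) = trans (sum-map-++ f (g x) (concatMap g xs))
  (cong (λ z → sum (map f (g x)) + z) (sum-map-concatMap f g xs))

sum-map-* : ∀ {A : Set} a (f : A → ℕ) xs → sum (map (λ x → a * f x) xs) ≡ a * sum (map f xs)
sum-map-* a f []       = sym (*-zeroʳ a)
sum-map-* a f (x ∷ xs) = trans (cong (λ z → a * f x + z) (sum-map-* a f xs)) (sym (*-distribˡ-+ a (f x) _))

sum-cartesianProduct : ∀ {A B : Set} (f : A → ℕ) (g : B → ℕ) xs ys →
  sum (map (uncurry λ x y → f x * g y) (cartesianProduct xs ys)) ≡ sum (map f xs) * sum (map g ys)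
sum-cartesianProduct f g []       ys = refl
sum-cartesianProduct f g (x ∷ xs) ys = begin
  sum (map fg (map (x ,_) ys ++ cartesianProduct xs ys))
    ≡⟨ sum-map-++ fg (map (x ,_) ys) (cartesianProduct xs ys) ⟩
  sum (map fg (map (x ,_) ys)) + sum (map fg (cartesianProduct xs ys))
    ≡⟨ cong₂ _+_ (trans (cong sum (sym (map-∘ ys))) (sum-map-* (f x) g ys)) (sum-cartesianProduct f g xs ys) ⟩
  f x * sum (map g ys) + sum (map f xs) * sum (map g ys)
    ≡⟨ *-distribʳ-+ (sum (map g ys)) (f x) (sum (map f xs)) ⟨
  (f x + sum (map f xs)) * sum (map g ys) ∎
  where
  open ≡-Reasoning
  fg = uncurry λ x y → f x * g y

-- The generating function divided by (1 - q)^N.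
seriesSum : ℕ → List Word → PS
seriesSum N = foldr (λ w s → binomialSeries N (cdes w) +ₚ s) zeroₚ

cdesGF-Δ^ : ∀ N ws → cdesGF ws ≗ Δ^ N (seriesSum N ws)
cdesGF-Δ^ N []       k = sym (Δ^-zeroₚ N k)
cdesGF-Δ^ N (w ∷ ws) k = sym (trans
  (Δ^-+ₚ N (binomialSeries N (cdes w)) (seriesSum N ws) k)
  (cong₂ ℤ._+_ (Δ^-binomialSeries N (cdes w) k) (sym (cdesGF-Δ^ N ws k))))

seriesSum-map : ∀ N r (f : Word → ℕ) ws →
  (∀ {w} → w ∈ ws → binomialSeries N (cdes w) r ≡ + f w) → seriesSum N ws r ≡ + sum (map f ws)
seriesSum-map N r f []       eq = refl
seriesSum-map N r f (w ∷ ws) eq = cong₂ ℤ._+_ (eq (here refl)) (seriesSum-map N r f ws (eq ∘ there))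

suc-∸-∸1 : ∀ a c → suc a ∸ c ∸ 1 ≡ a ∸ c
suc-∸-∸1 a c = trans (∸-+-assoc (suc a) c 1) (cong (suc a ∸_) (+-comm c 1))

unique-↭ : ∀ {w w′ : Word} → w ↭ w′ → Unique w → Unique w′
unique-↭ w↭w′ = ↭ₛ.Unique-resp-↭ (setoid ℤ) (↭⇒↭ₛ w↭w′)

-- Linear words rather than classes; in the setting below each class occurs with all its rotations.
cycShuffles : Word → Word → List Word
cycShuffles u v = concatMap (uncurry shuffles) (cartesianProduct (rotations u) (rotations v))

-- Cyclic shuffles as shuffles of rotations

module CyclicShuffle
  (A B : Word) (A! : Unique A) (B! : Unique B) (A#B : ∀ x → x ∈ A → x ∉ B)
  (1≤|A| : 1 ≤ length A) (1≤|B| : 1 ≤ length B)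
  (u v : Word) (u↭A : u ↭ A) (v↭B : v ↭ B) where

  open DecMembership ℤ._≟_ using (_∈?_)

  -- The rotation of `w` in the definition of a cyclic shuffle is transferred to the two subwords,
  -- so that `w` itself contains them.
  ContainsRotations : Word → Set
  ContainsRotations w = ∃[ x ] ∃[ y ] (CycEq u x × CycEq v y × x ⊆ w × y ⊆ w)

  isCycShuffle⇒contains : ∀ {w} → IsCycShuffle A B u v w → ContainsRotations w
  isCycShuffle⇒contains {w} (_ , k , i , j , uᵢ⊆ , vⱼ⊆) =
    let x , uᵢ~x , x⊆w = ⊆-cycEq uᵢ⊆ (cycEq-sym (k , refl))
        y , vⱼ~y , y⊆w = ⊆-cycEq vⱼ⊆ (cycEq-sym (k , refl))
    in x , y , cycEq-trans (i , refl) uᵢ~x , cycEq-trans (j , refl) vⱼ~y , x⊆w , y⊆w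

  contains⇒isCycShuffle : ∀ {w} → w ↭ A ++ B → ContainsRotations w → IsCycShuffle A B u v w
  contains⇒isCycShuffle {w} w↭ (x , y , (i , uᵢ≡x) , (j , vⱼ≡y) , x⊆w , y⊆w) =
    -- Rotation by 0 turns `w` into `w ++ []`.
    w↭ , 0 , i , j , subst₂ _⊆_ (sym uᵢ≡x) (sym (++-identityʳ w)) x⊆w
                   , subst₂ _⊆_ (sym vⱼ≡y) (sym (++-identityʳ w)) y⊆w

  isCycShuffle-cycEq : ∀ {w w′} → IsCycShuffle A B u v w → CycEq w w′ → IsCycShuffle A B u v w′
  isCycShuffle-cycEq w-shuffle@(w↭ , _) w~w′ =
    let x , y , u~x , v~y , x⊆w , y⊆w = isCycShuffle⇒contains w-shuffle
        x′ , x~x′ , x′⊆w′ = ⊆-cycEq x⊆w w~w′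
        y′ , y~y′ , y′⊆w′ = ⊆-cycEq y⊆w w~w′
    in contains⇒isCycShuffle (↭-trans (↭-sym (cycEq⇒↭ w~w′)) w↭)
         (x′ , y′ , cycEq-trans u~x x~x′ , cycEq-trans v~y y~y′ , x′⊆w′ , y′⊆w′)

  rotation-↭A : ∀ {x} → CycEq u x → x ↭ A
  rotation-↭A u~x = ↭-trans (↭-sym (cycEq⇒↭ u~x)) u↭A

  rotation-↭B : ∀ {y} → CycEq v y → y ↭ B
  rotation-↭B v~y = ↭-trans (↭-sym (cycEq⇒↭ v~y)) v↭B

  rotation-∈A : ∀ {x} → CycEq u x → All (_∈ A) x
  rotation-∈A u~x = All.tabulate (∈-resp-↭ (rotation-↭A u~x))

  rotation-∉A : ∀ {y} → CycEq v y → All (_∉ A) y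
  rotation-∉A v~y = All.tabulate λ b∈y b∈A → A#B _ b∈A (∈-resp-↭ (rotation-↭B v~y) b∈y)

  rotations-disjoint : ∀ {x y} → CycEq u x → CycEq v y → ∀ {a b} → a ∈ x → b ∈ y → a ≢ b
  rotations-disjoint u~x v~y a∈x b∈y refl = All.lookup (rotation-∉A v~y) b∈y (All.lookup (rotation-∈A u~x) a∈x)

  1≤|u| : 1 ≤ length u
  1≤|u| = subst (1 ≤_) (sym (↭-length u↭A)) 1≤|A|

  1≤|v| : 1 ≤ length v
  1≤|v| = subst (1 ≤_) (sym (↭-length v↭B)) 1≤|B|

  ∈-cycShuffles⁻ : ∀ {w} → w ∈ cycShuffles u v → IsCycShuffle A B u v w
  ∈-cycShuffles⁻ {w} w∈ =
    let (x , y) , xy∈ , w∈xy = find (∈-concatMap⁻ (uncurry shuffles) {xs = cartesianProduct (rotations u) (rotations v)} w∈)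
        x∈ , y∈ = ∈-cartesianProduct⁻ (rotations u) (rotations v) xy∈
        u~x = ∈-rotations⁻ u x∈
        v~y = ∈-rotations⁻ v y∈
        x≡ , y≡ = filter-shuffle (_∈? A) x y (rotation-∈A u~x) (rotation-∉A v~y) w∈xy
    in contains⇒isCycShuffle
         (↭-trans (shuffles-↭ x y w∈xy) (++⁺ (rotation-↭A u~x) (rotation-↭B v~y)))
         (x , y , u~x , v~y , subst (_⊆ w) x≡ (Sublist.filter-⊆ (_∈? A) w)
                            , subst (_⊆ w) y≡ (Sublist.filter-⊆ (¬? ∘ (_∈? A)) w))

  -- The two rotations inside `w` can only be its restrictions to the letters in `A` and to those
  -- outside `A`, and `w` is a shuffle of these restrictions.
  ∈-cycShuffles⁺ : ∀ {w} → IsCycShuffle A B u v w → w ∈ cycShuffles u v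
  ∈-cycShuffles⁺ {w} w-shuffle@(w↭ , _) =
    let x , y , u~x , v~y , x⊆w , y⊆w = isCycShuffle⇒contains w-shuffle
        A-∈A = All.tabulate (λ a∈A → a∈A)
        B-∉A = All.tabulate (λ b∈B b∈A → A#B _ b∈A b∈B)
        x≡ = ⊆⇒≡filter (_∈? A) x⊆w (rotation-↭A u~x) w↭ A-∈A B-∉A
        y≡ = ⊆⇒≡filter (¬? ∘ (_∈? A)) y⊆w (rotation-↭B v~y) (↭-trans w↭ (++-comm A B))
               B-∉A (All.map (λ p ¬p → ¬p p) A-∈A)
    in ∈-concatMap⁺ (uncurry shuffles) (lose
         (∈-cartesianProduct⁺ (∈-rotations⁺ 1≤|u| u~x) (∈-rotations⁺ 1≤|v| v~y))
         (subst₂ (λ x y → w ∈ shuffles x y) (sym x≡) (sym y≡) (∈-shuffles-filter (_∈? A) w)))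

  cycShuffles-unique : Unique (cycShuffles u v)
  cycShuffles-unique = concatMap-unique (uncurry shuffles)
    (Unique.cartesianProduct⁺ (rotations-unique (unique-↭ (↭-sym u↭A) A!)) (rotations-unique (unique-↭ (↭-sym v↭B) B!)))
    (λ {(x , y)} xy∈ → let u~x , v~y = pair xy∈ in shuffles-unique x y (rotations-disjoint u~x v~y))
    λ {(x , y)} {(x′ , y′)} xy∈ xy′∈ w∈xy w∈xy′ →
      let u~x , v~y = pair xy∈
          u~x′ , v~y′ = pair xy′∈
          x≡ , y≡ = filter-shuffle (_∈? A) x y (rotation-∈A u~x) (rotation-∉A v~y) w∈xy
          x′≡ , y′≡ = filter-shuffle (_∈? A) x′ y′ (rotation-∈A u~x′) (rotation-∉A v~y′) w∈xy′
      in cong₂ _,_ (trans (sym x≡) x′≡) (trans (sym y≡) y′≡)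
    where
    pair : ∀ {x y} → (x , y) ∈ cartesianProduct (rotations u) (rotations v) → CycEq u x × CycEq v y
    pair xy∈ = let x∈ , y∈ = ∈-cartesianProduct⁻ (rotations u) (rotations v) xy∈ in
      ∈-rotations⁻ u x∈ , ∈-rotations⁻ v y∈

  -- Cyclic equivalence is decidable, so one word per class can be kept from the finite list
  -- `cycShuffles u v`.
  repSystem : Σ (List Word) (IsRepSystem A B u v)
  repSystem = deduplicate cycEq? (cycShuffles u v)
    , All.deduplicate⁺ cycEq? (All.tabulate ∈-cycShuffles⁻)
    , DecUnique.deduplicate-! cycEq-decSetoid (cycShuffles u v)
    , λ w w-shuffle → Any.deduplicate⁺ cycEq? (λ y~x w~x → cycEq-trans w~x (cycEq-sym y~x))
        (Any.map (λ { refl → cycEq-refl }) (∈-cycShuffles⁺ w-shuffle))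

  sum-placements-cycShuffles : ∀ ρ → let P = placements ρ nothing in
    sum (map P (cycShuffles u v)) ≡ sum (map P (rotations u)) * sum (map P (rotations v))
  sum-placements-cycShuffles ρ = begin
    sum (map P (cycShuffles u v))                                ≡⟨ sum-map-concatMap P (uncurry shuffles) pairs ⟩
    sum (map (λ xy → sum (map P (uncurry shuffles xy))) pairs)   ≡⟨ sum-map-cong-∈ pairs (λ {(x , y)} xy∈ →
        let x∈ , y∈ = ∈-cartesianProduct⁻ (rotations u) (rotations v) xy∈ in
        placements-shuffle ρ nothing x y (rotations-disjoint (∈-rotations⁻ u x∈) (∈-rotations⁻ v y∈))) ⟩
    sum (map (uncurry λ x y → P x * P y) pairs)                  ≡⟨ sum-cartesianProduct P P (rotations u) (rotations v) ⟩
    sum (map P (rotations u)) * sum (map P (rotations v))        ∎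
    where
    open ≡-Reasoning
    P = placements ρ nothing
    pairs = cartesianProduct (rotations u) (rotations v)

  -- Arbitrary systems of representatives

  module RepSystem {Ws : List Word} (Ws-rep : IsRepSystem A B u v Ws) where

    isShuffle : ∀ {w} → w ∈ Ws → IsCycShuffle A B u v w
    isShuffle = All.lookup (proj₁ Ws-rep)

    length-member : ∀ {w} → w ∈ Ws → length w ≡ length A + length B
    length-member w∈ = trans (↭-length (proj₁ (isShuffle w∈))) (length-++ A)

    unique-member : ∀ {w} → w ∈ Ws → Unique w
    unique-member w∈ = unique-↭ (↭-sym (proj₁ (isShuffle w∈))) (Unique.++⁺ A! B! (λ (a∈A , a∈B) → A#B _ a∈A a∈B))

    -- Inequivalent representatives have no rotation in common, and every cyclic shuffle is a
    -- rotation of some representative. Both lists are thus duplicate-free with the same members.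
    rotations-↭-cycShuffles : concatMap rotations Ws ↭ cycShuffles u v
    rotations-↭-cycShuffles = ∼bag⇒↭ (unique∧set⇒bag
      (concatMap-unique rotations
        (AllPairs.map (λ w≁w′ w≡w′ → w≁w′ (subst (CycEq _) w≡w′ cycEq-refl)) inequivalent)
        (rotations-unique ∘ unique-member)
        (λ {w} {w′} w∈ w′∈ z∈w z∈w′ → AllPairs-¬⇒≡ cycEq-sym inequivalent w∈ w′∈
          (cycEq-trans (∈-rotations⁻ w z∈w) (cycEq-sym (∈-rotations⁻ w′ z∈w′)))))
      cycShuffles-unique
      (mk⇔
        (λ z∈ → let w , w∈ , z∈w = find (∈-concatMap⁻ rotations {xs = Ws} z∈) in
          ∈-cycShuffles⁺ (isCycShuffle-cycEq (isShuffle w∈) (∈-rotations⁻ w z∈w)))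
        (λ z∈ → let w , w∈ , z~w = find (proj₂ (proj₂ Ws-rep) _ (∈-cycShuffles⁻ z∈)) in
          ∈-concatMap⁺ rotations (lose w∈ (∈-rotations⁺
            (subst (1 ≤_) (sym (length-member w∈)) (≤-trans 1≤|A| (m≤m+n (length A) (length B))))
            (cycEq-sym z~w))))))
      where
      inequivalent : AllPairs (λ w w′ → ¬ CycEq w w′) Ws
      inequivalent = proj₁ (proj₂ Ws-rep)

    module _ {m n : ℕ} (|A| : length A ≡ suc m) (|B| : length B ≡ suc n) where

      length-w : ∀ {w} → w ∈ Ws → length w ≡ suc (m + suc n)
      length-w w∈ = trans (length-member w∈) (cong₂ _+_ |A| |B|)

      -- With r = `suc ρ`, placements of all words in `cycShuffles u v` are summed twice. Grouping
      -- by class gives one factor r, and grouping by pairs of rotations gives two; since r is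
      -- nonzero, one cancels.
      sum-C : ∀ ρ → sum (map (λ w → (ρ + suc (m + suc n) ∸ cdes w) C (m + suc n)) Ws) ≡
        ((ρ + suc m ∸ cdes u) C m) * ((ρ + suc n ∸ cdes v) C n) * suc ρ
      sum-C ρ = *-cancelˡ-≡ _ _ (suc ρ) (begin
        suc ρ * sum (map (λ w → (ρ + suc (m + suc n) ∸ cdes w) C (m + suc n)) Ws)
          ≡⟨ sum-map-* (suc ρ) _ Ws ⟨
        sum (map (λ w → suc ρ * ((ρ + suc (m + suc n) ∸ cdes w) C (m + suc n))) Ws)
          ≡⟨ sum-map-cong-∈ Ws (λ {w} w∈ → sum-placements-rotations ρ (m + suc n) w (length-w w∈)) ⟨
        sum (map (λ w → sum (map P (rotations w))) Ws)
          ≡⟨ sum-map-concatMap P rotations Ws ⟨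
        sum (map P (concatMap rotations Ws))
          ≡⟨ sum-↭ (map-↭ P rotations-↭-cycShuffles) ⟩
        sum (map P (cycShuffles u v))
          ≡⟨ sum-placements-cycShuffles ρ ⟩
        sum (map P (rotations u)) * sum (map P (rotations v))
          ≡⟨ cong₂ _*_ (sum-placements-rotations ρ m u (trans (↭-length u↭A) |A|))
                       (sum-placements-rotations ρ n v (trans (↭-length v↭B) |B|)) ⟩
        (suc ρ * X) * (suc ρ * Y)
          ≡⟨ regroup (suc ρ) X Y ⟩
        suc ρ * (X * Y * suc ρ) ∎)
        where
        open ≡-Reasoning
        P = placements ρ nothing
        X Y : ℕ
        X = (ρ + suc m ∸ cdes u) C m
        Y = (ρ + suc n ∸ cdes v) C n
        regroup : ∀ s x y → (s * x) * (s * y) ≡ s * (x * y * s)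
        regroup = solve-∀

      seriesSum-rhs : seriesSum (suc (m + suc n)) Ws ≗ rhsSeries (suc m) (suc n) (cdes u) (cdes v)
      -- At r = 0 the right side has the factor r. On the left every word has at least two letters,
      -- hence a cyclic descent and no constant coefficient.
      seriesSum-rhs zero = begin
        seriesSum (suc (m + suc n)) Ws 0               ≡⟨ seriesSum-map _ 0 (λ _ → 0) Ws (λ w∈ → binomialSeries-zero _
                                          (cdes-positive (unique-member w∈)
                                            (subst (2 ≤_) (sym (length-w w∈)) (s≤s (≤-trans (s≤s z≤n) (m≤n+m (suc n) m)))))) ⟩
        + sum (map (λ _ → 0) Ws)     ≡⟨ cong +_ (sum-map-zero Ws) ⟩
        + 0                          ≡⟨ cong +_ (*-zeroʳ (((suc m ∸ cdes u ∸ 1) C m) * ((suc n ∸ cdes v ∸ 1) C n))) ⟨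
        rhsSeries (suc m) (suc n) (cdes u) (cdes v) 0 ∎
        where open ≡-Reasoning
      seriesSum-rhs (suc ρ) = begin
        seriesSum (suc (m + suc n)) Ws (suc ρ)
          ≡⟨ seriesSum-map _ (suc ρ) (λ w → (ρ + suc (m + suc n) ∸ cdes w) C (m + suc n)) Ws (λ {w} w∈ →
               trans (binomialSeries-C (m + suc n) (cdes w) (suc ρ)
                       (≤-trans (cdes-≤-length w) (≤-trans (≤-reflexive (length-w w∈)) (s≤s (m≤n+m (m + suc n) ρ)))))
                     (cong (λ z → + ((z ∸ cdes w) C (m + suc n))) (sym (+-suc ρ (m + suc n))))) ⟩
        + sum (map (λ w → (ρ + suc (m + suc n) ∸ cdes w) C (m + suc n)) Ws)
          ≡⟨ cong +_ (sum-C ρ) ⟩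
        + (((ρ + suc m ∸ cdes u) C m) * ((ρ + suc n ∸ cdes v) C n) * suc ρ)
          ≡⟨ cong₂ (λ x y → + ((x C m) * (y C n) * suc ρ)) (suc-∸-∸1 (ρ + suc m) (cdes u)) (suc-∸-∸1 (ρ + suc n) (cdes v)) ⟨
        rhsSeries (suc m) (suc n) (cdes u) (cdes v) (suc ρ) ∎
        where open ≡-Reasoning

      cdesGF-formula : cdesGF Ws ≗ (oneMinusQ ^ₚ (suc m + suc n)) *ₚ rhsSeries (suc m) (suc n) (cdes u) (cdes v)
      cdesGF-formula k = begin
        cdesGF Ws k                              ≡⟨ cdesGF-Δ^ (suc m + suc n) Ws k ⟩
        Δ^ (suc m + suc n) (seriesSum (suc m + suc n) Ws) k      ≡⟨ Δ^-cong (suc m + suc n) seriesSum-rhs k ⟩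
        Δ^ (suc m + suc n) (rhsSeries (suc m) (suc n) (cdes u) (cdes v)) k
          ≡⟨ oneMinusQ^-*ₚ (suc m + suc n) (rhsSeries (suc m) (suc n) (cdes u) (cdes v)) k ⟨
        ((oneMinusQ ^ₚ (suc m + suc n)) *ₚ rhsSeries (suc m) (suc n) (cdes u) (cdes v)) k ∎
        where open ≡-Reasoning

theorem5p10 : (A B : List ℤ) → Unique A → Unique B → (∀ x → x ∈ A → x ∉ B) →
    1 ≤ length A → 1 ≤ length B →
    (u v : List ℤ) → u ↭ A → v ↭ B →
    Σ (List Word) (IsRepSystem A B u v) ×
    ((Ws : List Word) → IsRepSystem A B u v Ws → (k : ℕ) →
    cdesGF Ws k ≡
    ((oneMinusQ ^ₚ (length A + length B)) *ₚ
    rhsSeries (length A) (length B) (cdes u) (cdes v)) k)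
-- Matching on nonempty lists turns both lengths into successors, so the length equations hold by
-- `refl`.
theorem5p10 A@(_ ∷ _) B@(_ ∷ _) A! B! A#B 1≤|A| 1≤|B| u v u↭A v↭B =
  repSystem , λ Ws Ws-rep k → RepSystem.cdesGF-formula Ws-rep refl refl k
  where open CyclicShuffle A B A! B! A#B 1≤|A| 1≤|B| u v u↭A v↭B
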